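{- For any instance $(Q,C,D)$ of the bilinear assignment problem (of sizes $m,n$) in which the elements of $Q$ are restricted to non-negative integers and $C$, $D$ are zero matrices, the local search algorithm that explores the $2$-exchange neighborhood will reach a solution with cost at most $\frac{2mn}{m+n}\,\mathcal{A}(Q,C,D)$ in $$O\left(\frac{m^2+n^2}{m+n}\,\log\sum q_{ijkl}\right)$$ iterations, where the sum is over all $i,j\in M$ and $k,l\in N$.
   Context: Bilinear assignment problem (BAP): let $m\le n$ be positive integers, $M=\{1,\dots,m\}$, $N=\{1,\dots,n\}$. An instance $(Q,C,D)$ consists of an $m\times m\times n\times n$ array $Q=(q_{ijkl})$, an $m\times m$ matrix $C=(c_{ij})$ and an $n\times n$ matrix $D=(d_{kl})$. Let $\mathcal{X}$ (resp. $\mathcal{Y}$) be the set of $m\times m$ (resp. $n\times n$) permutation matrices. The feasible set is $\mathcal{F}=\mathcal{X}\times\mathcal{Y}$, and the objective (cost), to be minimized, is $$f(\mathbf{x},\mathbf{y})=\sum_{i,j\in M}\sum_{k,l\in N} q_{ijkl}x_{ij}y_{kl}+\sum_{i,j\in M}c_{ij}x_{ij}+\sum_{k,l\in N}d_{kl}y_{kl}.$$ $\mathcal{A}(Q,C,D)$ is the average of $f$ over all feasible solutions. The $2$-exchange neighborhood of $(\mathbf{x},\mathbf{y})\in\mathcal{F}$ consists of all $(\mathbf{x}',\mathbf{y})$ where $\mathbf{x}'$ is obtained from $\mathbf{x}$ by swapping the assignments of two indices $i_1,i_2\in M$ (if $x_{i_1j_1}=x_{i_2j_2}=1$, then $x'_{i_1j_2}=x'_{i_2j_1}=1$,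 $x'_{i_1j_1}=x'_{i_2j_2}=0$, all else unchanged), together with all $(\mathbf{x},\mathbf{y}')$ where $\mathbf{y}'$ is obtained from $\mathbf{y}$ in the same way by swapping the assignments of two indices $k_1,k_2\in N$. The local search algorithm that explores this neighborhood starts from a feasible solution and repeatedly moves from the current solution to a best solution in its neighborhood, as long as this strictly decreases the objective value; each such move is one iteration. The solution reached in the claim need not be a local optimum. -}

module Defs where

open import Data.Bool.Base using (if_then_else_)
open import Data.Fin.Base using (Fin; zero; suc; punchIn)
open import Data.Fin.Permutation
  using (Permutation′; _⟨$⟩ʳ_; _∘ₚ_; transpose; insert; remove; insert-remove; insert-punchIn)
  renaming (_≈_ to _≈ₚ_; id to idₚ)
open import Data.Fin.Properties using (_≟_; punchIn-injective)
open import Data.Integer.Base using (+_)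
open import Data.List.Base
  using (List; []; _∷_; _++_; map; filter; foldr; length; allFin; cartesianProduct; cartesianProductWith)
open import Data.List.Membership.Propositional.Properties
  using (∈-allFin; ∈-filter⁺; ∈-filter⁻; ∈-cartesianProduct⁺; ∈-map⁺; ∈-map⁻; ∈-++⁺ˡ; ∈-++⁺ʳ; ∈-++⁻)
open import Data.List.Membership.Propositional using (_∈_)
import Data.List.Relation.Unary.All as All
import Data.List.Membership.Setoid.Properties as Membership
open import Data.List.Relation.Unary.Any using (Any; here; there)
open import Data.List.Relation.Unary.Enumerates.Setoid using (IsEnumeration)
import Data.List.Relation.Unary.Enumerates.Setoid.Properties as Enumerates
import Data.List.Relation.Unary.AllPairs as AllPairs
open import Data.List.Relation.Unary.Unique.Setoid using (Unique)
import Data.List.Relation.Unary.Unique.Setoid.Properties as Unique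
import Data.List.Relation.Unary.Unique.Propositional.Properties as Uniqueₚ
open import Data.Nat.Base as ℕ using (ℕ; NonZero)
import Data.Nat.Properties as ℕ
open import Data.Product.Base using (_×_; _,_; proj₁; proj₂; ∃-syntax)
open import Data.Product.Relation.Binary.Pointwise.NonDependent using (_×ₛ_)
open import Data.Rational.Base using (ℚ; 0ℚ; 1ℚ; _+_; _*_; _≤_; _<_; _/_)
import Data.Rational.Properties as ℚ
open import Data.Sum.Base using (_⊎_; inj₁; inj₂)
open import Level using (0ℓ)
open import Relation.Binary.Bundles using (Setoid; DecTotalOrder)
open import Relation.Binary.PropositionalEquality
  using (_≡_; _≢_; refl; sym; trans; cong; setoid)
open import Relation.Nullary.Decidable using (Dec; does; yes; no; ¬?)
open import Relation.Nullary.Negation using (contradiction)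

open import Algebra.Bundles using (CommutativeRing)
open import Algebra.Properties.Semiring.Sum (CommutativeRing.semiring ℚ.+-*-commutativeRing)
  using (sum-syntax)
open import Data.List.Extrema (DecTotalOrder.totalOrder ℚ.≤-decTotalOrder)
  using (argmin; argmin-sel; f[argmin]≤f[xs])
import Algebra.Properties.Semiring.Sum ℕ.+-*-semiring as ℕΣ

private
  variable
    m n : ℕ

------------------------------------------------------------------------
-- Instances and feasible solutions

Matrix : ℕ → Set
Matrix n = Fin n → Fin n → ℚ

record Instance (m n : ℕ) : Set where
  field
    q : Fin m → Fin m → Fin n → Fin n → ℚ
    c : Matrix m
    d : Matrix n

-- The pair (σ , τ) stands for the pair of permutation matrices
-- (permMatrix σ , permMatrix τ).
Solution : ℕ → ℕ → Set
Solution m n = Permutation′ m × Permutation′ n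

permMatrix : Permutation′ n → Matrix n
permMatrix σ i j = if does (σ ⟨$⟩ʳ i ≟ j) then 1ℚ else 0ℚ

cost : Instance m n → Solution m n → ℚ
cost {m} {n} I (σ , τ) =
    (∑[ i < m ] ∑[ j < m ] ∑[ k < n ] ∑[ l < n ] (q i j k l * x i j * y k l))
  + (∑[ i < m ] ∑[ j < m ] (c i j * x i j))
  + (∑[ k < n ] ∑[ l < n ] (d k l * y k l))
  where
  open Instance I
  x = permMatrix σ
  y = permMatrix τ

------------------------------------------------------------------------
-- The average cost of a feasible solution

permutations : ∀ n → List (Permutation′ n)
permutations ℕ.zero    = idₚ ∷ []
permutations (ℕ.suc n) = cartesianProductWith (insert zero) (allFin (ℕ.suc n)) (permutations n)

solutions : ∀ m n → List (Solution m n)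
solutions m n = cartesianProduct (permutations m) (permutations n)

permutationSetoid : ℕ → Setoid 0ℓ 0ℓ
permutationSetoid n = record
  { Carrier       = Permutation′ n
  ; _≈_           = _≈ₚ_
  ; isEquivalence = record
    { refl  = λ _ → refl
    ; sym   = λ p i → sym (p i)
    ; trans = λ p r i → trans (p i) (r i)
    }
  }

-- `solutions m n` lists every feasible solution exactly once.

private
  insert-cong : ∀ {j j′} {π ρ : Permutation′ n} → j ≡ j′ → π ≈ₚ ρ → insert zero j π ≈ₚ insert zero j′ ρ
  insert-cong refl π≈ρ zero = refl
  insert-cong {j = j} {π = π} {ρ} refl π≈ρ (suc k) =
    trans (insert-punchIn zero j π k)
      (trans (cong (punchIn j) (π≈ρ k)) (sym (insert-punchIn zero j ρ k)))

  insert-injective : ∀ {j j′} {π ρ : Permutation′ n} →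
                     insert zero j π ≈ₚ insert zero j′ ρ → j ≡ j′ × π ≈ₚ ρ
  insert-injective {j = j} {π = π} {ρ} eq with refl ← eq zero = refl , λ k →
    punchIn-injective j _ _
      (trans (sym (insert-punchIn zero j π k)) (trans (eq (suc k)) (insert-punchIn zero j ρ k)))

permutations-complete : ∀ n → IsEnumeration (permutationSetoid n) (permutations n)
permutations-complete ℕ.zero    π = here λ ()
permutations-complete (ℕ.suc n) π =
  Membership.∈-resp-≈ S {x = insert zero (π ⟨$⟩ʳ zero) (remove zero π)} {y = π} (insert-remove zero π)
    (Membership.∈-cartesianProductWith⁺ (setoid _) (permutationSetoid n) S insert-cong
      (∈-allFin (π ⟨$⟩ʳ zero)) (permutations-complete n (remove zero π)))
  where S = permutationSetoid (ℕ.suc n)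

permutations-unique : ∀ n → Unique (permutationSetoid n) (permutations n)
permutations-unique ℕ.zero    = All.[] AllPairs.∷ AllPairs.[]
permutations-unique (ℕ.suc n) =
  Unique.cartesianProductWith⁺ (setoid _) (permutationSetoid n) (permutationSetoid (ℕ.suc n))
    (insert zero) insert-injective (Uniqueₚ.allFin⁺ (ℕ.suc n)) (permutations-unique n)

solutionSetoid : ℕ → ℕ → Setoid 0ℓ 0ℓ
solutionSetoid m n = permutationSetoid m ×ₛ permutationSetoid n

solutions-complete : ∀ m n → IsEnumeration (solutionSetoid m n) (solutions m n)
solutions-complete m n =
  Enumerates.cartesianProduct⁺ (permutationSetoid m) (permutationSetoid n)
    (permutations-complete m) (permutations-complete n)

solutions-unique : ∀ m n → Unique (solutionSetoid m n) (solutions m n)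
solutions-unique m n =
  Unique.cartesianProduct⁺ (permutationSetoid m) (permutationSetoid n)
    (permutations-unique m) (permutations-unique n)

solutions-nonEmpty : ∀ m n → NonZero (length (solutions m n))
solutions-nonEmpty m n = inhabited (solutions-complete m n (idₚ , idₚ))
  where
  inhabited : ∀ {P : Solution m n → Set} {xs} → Any P xs → NonZero (length xs)
  inhabited (here _)  = _
  inhabited (there _) = _

𝒜 : Instance m n → ℚ
𝒜 {m} {n} I =
  foldr _+_ 0ℚ (map (cost I) (solutions m n))
  * (_/_ (+ 1) (length (solutions m n)) {{solutions-nonEmpty m n}})

------------------------------------------------------------------------
-- Local search in the 2-exchange neighborhood

-- `π ∘ₚ σ` applies π first, so i₁ receives the former image of i₂ and vice versa.
data _∈𝒩_ {m n : ℕ} : Solution m n → Solution m n → Set where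
  swapˣ : ∀ {σ τ} i₁ i₂ → i₁ ≢ i₂ → (transpose i₁ i₂ ∘ₚ σ , τ) ∈𝒩 (σ , τ)
  swapʸ : ∀ {σ τ} k₁ k₂ → k₁ ≢ k₂ → (σ , transpose k₁ k₂ ∘ₚ τ) ∈𝒩 (σ , τ)

record Iteration (I : Instance m n) (s s′ : Solution m n) : Set where
  field
    neighbor  : s′ ∈𝒩 s
    best      : ∀ {r} → r ∈𝒩 s → cost I s′ ≤ cost I r
    decreases : cost I s′ < cost I s

LocalOptimum : Instance m n → Solution m n → Set
LocalOptimum I s = ∀ {r} → r ∈𝒩 s → cost I s ≤ cost I r

-- `s t` is the current solution after t iterations, with arbitrary start
-- and arbitrary choice among equally good neighbors; once the algorithm
-- has stopped, the sequence stays at the final solution.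
IsLocalSearch : Instance m n → (ℕ → Solution m n) → Set
IsLocalSearch I s = ∀ t →
    Iteration I (s t) (s (ℕ.suc t))
  ⊎ (LocalOptimum I (s t) × s (ℕ.suc t) ≡ s t)

-- Such a sequence exists from every starting solution.

private
  distinctPairs : ∀ n → List (Fin n × Fin n)
  distinctPairs n = filter (λ (i , j) → ¬? (i ≟ j)) (cartesianProduct (allFin n) (allFin n))

  exchangeˣ exchangeʸ : (s : Solution m n) → List (Solution m n)
  exchangeˣ (σ , τ) = map (λ (i , j) → transpose i j ∘ₚ σ , τ) (distinctPairs _)
  exchangeʸ (σ , τ) = map (λ (i , j) → σ , transpose i j ∘ₚ τ) (distinctPairs _)

  neighbors : Solution m n → List (Solution m n)
  neighbors s = exchangeˣ s ++ exchangeʸ s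

  ∈-distinctPairs : ∀ {i j : Fin n} → i ≢ j → (i , j) ∈ distinctPairs n
  ∈-distinctPairs {i = i} {j} i≢j =
    ∈-filter⁺ (λ (i , j) → ¬? (i ≟ j)) (∈-cartesianProduct⁺ (∈-allFin i) (∈-allFin j)) i≢j

  neighbors-complete : ∀ {r s : Solution m n} → r ∈𝒩 s → r ∈ neighbors s
  neighbors-complete (swapˣ _ _ i≢j) = ∈-++⁺ˡ (∈-map⁺ _ (∈-distinctPairs i≢j))
  neighbors-complete {s = s} (swapʸ _ _ i≢j) = ∈-++⁺ʳ (exchangeˣ s) (∈-map⁺ _ (∈-distinctPairs i≢j))

  neighbors-sound : ∀ (s : Solution m n) {r} → r ∈ neighbors s → r ∈𝒩 s
  neighbors-sound {m} {n} s r∈ with ∈-++⁻ (exchangeˣ s) r∈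
  ... | inj₁ r∈ˣ with (i , j) , ij∈ , refl ← ∈-map⁻ _ r∈ˣ =
    swapˣ i j (proj₂ (∈-filter⁻ (λ (i , j) → ¬? (i ≟ j)) {xs = cartesianProduct (allFin m) (allFin m)} ij∈))
  ... | inj₂ r∈ʸ with (i , j) , ij∈ , refl ← ∈-map⁻ _ r∈ʸ =
    swapʸ i j (proj₂ (∈-filter⁻ (λ (i , j) → ¬? (i ≟ j)) {xs = cartesianProduct (allFin n) (allFin n)} ij∈))

  next : ∀ (I : Instance m n) s → ∃[ s′ ] (Iteration I s s′ ⊎ (LocalOptimum I s × s′ ≡ s))
  next {m} {n} I s =
    step (argmin (cost I) s (neighbors s)) (argmin-sel (cost I) s (neighbors s))
      (λ r∈ → All.lookup (f[argmin]≤f[xs] s (neighbors s)) (neighbors-complete r∈))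
      (cost I (argmin (cost I) s (neighbors s)) ℚ.<? cost I s)
    where
    step : (b : Solution m n) → b ≡ s ⊎ b ∈ neighbors s → (∀ {r} → r ∈𝒩 s → cost I b ≤ cost I r) →
           Dec (cost I b < cost I s) → ∃[ s′ ] (Iteration I s s′ ⊎ (LocalOptimum I s × s′ ≡ s))
    step b (inj₁ b≡s) best (yes b<s) = contradiction b<s (ℚ.<-irrefl (cong (cost I) b≡s))
    step b (inj₂ b∈)  best (yes b<s) =
      b , inj₁ record { neighbor = neighbors-sound s b∈ ; best = best ; decreases = b<s }
    step b _          best (no b≮s)  = s , inj₂ ((λ r∈ → ℚ.≤-trans (ℚ.≮⇒≥ b≮s) (best r∈)) , refl)

localSearch-exists : ∀ (I : Instance m n) s₀ → ∃[ s ] (s 0 ≡ s₀ × IsLocalSearch I s)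
localSearch-exists {m} {n} I s₀ = run , refl , λ t → proj₂ (next I (run t))
  where
  run : ℕ → Solution m n
  run ℕ.zero    = s₀
  run (ℕ.suc t) = proj₁ (next I (run t))

------------------------------------------------------------------------
-- Quantities in the bounds

ℕ→ℚ : ℕ → ℚ
ℕ→ℚ k = + k / 1

total : (Fin m → Fin m → Fin n → Fin n → ℕ) → ℕ
total Q = ℕΣ.sum λ i → ℕΣ.sum λ j → ℕΣ.sum λ k → ℕΣ.sum λ l → Q i j k l

instance
  m+n-nonZero : .{{_ : NonZero m}} → NonZero (m ℕ.+ n)
  m+n-nonZero {m = ℕ.suc _} = _

{-# OPTIONS --safe #-}

-- Summed over all ordered pairs of indices, the 2-exchanges of (x , y) decrease the cost f by at
-- least 2(m + n) f − 4T, where T is the sum of all q_{ijkl}.  So a best exchange shrinks the excess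
-- (m + n) f − 2T by a factor 1 − 2(m + n)/(m² + n²) or better, and about (m² + n²)/(m + n) iterations
-- halve it.  After 1 + ⌊log₂ T⌋ halvings the excess is less than m + n; costs being integers, one
-- more iteration makes it nonpositive.  Finally T = mn 𝒜, as each index pair is chosen equally often.

module Submission where

open import Defs
open import Algebra.Bundles using (CommutativeRing)
open import Data.Bool.Base using (Bool; true; false; if_then_else_)
open import Data.Fin.Base using (Fin; zero; suc; punchIn)
open import Data.Fin.Permutation using (Permutation′; _⟨$⟩ʳ_; _∘ₚ_; transpose; insert; insert-punchIn)
open import Data.Fin.Properties using (_≟_)
open import Data.Integer.Base as ℤ using (+_; +≤+)
import Data.Integer.Properties as ℤ
open import Data.List.Base
  using (List; []; _∷_; _++_; map; foldr; length; lookup; tabulate; allFin; cartesianProductWith)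
open import Data.List.Properties using (length-tabulate)
open import Data.Nat.Base as ℕ using (ℕ; zero; suc; NonZero; _+_; _*_; _∸_; _^_; _≤_; _<_; z≤n)
open import Data.Nat.DivMod using (_%_; m≡m%n+[m/n]*n; m%n<n; m/n*n≤m)
open import Data.Nat.Logarithm using (⌊log₂_⌋; ⌊log₂⌋-mono-≤; ⌊log₂[2^n]⌋≡n)
open import Data.Nat.Properties hiding (_≟_)
open import Data.Nat.Tactic.RingSolver using (solve-∀)
open import Data.Product.Base using (_×_; _,_; ∃-syntax)
open import Data.Rational.Base as ℚ using (ℚ; 0ℚ; 1ℚ; toℚᵘ; _/_)
import Data.Rational.Properties as ℚ
open import Data.Rational.Unnormalised.Base as ℚᵘ using (mkℚᵘ; *≤*)
import Data.Rational.Unnormalised.Properties as ℚᵘ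
open import Data.Sum.Base using (_⊎_; inj₁; inj₂)
open import Function.Base using (_∘_)
open import Relation.Binary.PropositionalEquality
  using (_≡_; _≢_; refl; sym; trans; cong; cong₂; subst; subst₂; module ≡-Reasoning)
open import Relation.Nullary.Decidable using (does; yes; no; dec-true; dec-false)
import Algebra.Properties.Semiring.Sum (CommutativeRing.semiring ℚ.+-*-commutativeRing) as ℚΣ
open import Algebra.Properties.Semiring.Sum +-*-semiring

private
  variable
    m n : ℕ
    A B C : Set

-- Finite sums

sum-mono : {f g : Fin n → ℕ} → (∀ i → f i ≤ g i) → sum f ≤ sum g
sum-mono {zero}  f≤g = z≤n
sum-mono {suc n} f≤g = +-mono-≤ (f≤g zero) (sum-mono (f≤g ∘ suc))

term≤sum : (f : Fin n → ℕ) (i : Fin n) → f i ≤ sum f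
term≤sum f zero    = m≤m+n _ _
term≤sum f (suc i) = ≤-trans (term≤sum (f ∘ suc) i) (m≤n+m _ (f zero))

sum-const : ∀ n c → sum {n} (λ _ → c) ≡ n * c
sum-const zero    c = refl
sum-const (suc n) c = cong (c ℕ.+_) (sum-const n c)

sum-select : (f : Fin n → ℕ) (i : Fin n) → sum (λ j → if does (i ≟ j) then f j else 0) ≡ f i
sum-select {suc n} f zero    = trans (cong (f zero ℕ.+_) (sum-replicate-zero n)) (+-identityʳ _)
sum-select {suc n} f (suc i) = sum-select (f ∘ suc) i

sum-cong₂ : {f g : Fin m → Fin n → ℕ} → (∀ i j → f i j ≡ g i j) →
            (sum λ i → sum λ j → f i j) ≡ (sum λ i → sum λ j → g i j)
sum-cong₂ f≡g = sum-cong-≗ λ i → sum-cong-≗ (f≡g i)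

sum-distrib₂ : (f g : Fin m → Fin n → ℕ) →
               (sum λ i → sum λ j → f i j + g i j)
               ≡ (sum λ i → sum λ j → f i j) + (sum λ i → sum λ j → g i j)
sum-distrib₂ f g =
  trans (sum-cong-≗ λ i → ∑-distrib-+ (f i) (g i)) (∑-distrib-+ (sum ∘ f) (sum ∘ g))

*-distribˡ-sum₂ : ∀ c (f : Fin m → Fin n → ℕ) →
                  c * (sum λ i → sum λ j → f i j) ≡ (sum λ i → sum λ j → c * f i j)
*-distribˡ-sum₂ c f = trans (*-distribˡ-sum c (sum ∘ f)) (sum-cong-≗ λ i → *-distribˡ-sum c (f i))

∑-comm₂ : ∀ {l} (f : Fin l → Fin m → Fin n → ℕ) →
          (sum λ h → sum λ i → sum λ j → f h i j) ≡ (sum λ i → sum λ j → sum λ h → f h i j)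
∑-comm₂ f = trans (∑-comm λ h i → sum (f h i)) (sum-cong-≗ λ i → ∑-comm λ h j → f h i j)

-- Exchanges in a linear assignment

assignCost : (Fin n → Fin n → ℕ) → Permutation′ n → ℕ
assignCost a σ = sum λ i → a i (σ ⟨$⟩ʳ i)

-- Old entries are added on the left and new ones on the right, so no subtraction in ℕ occurs. Only
-- `k` equal to `i₁` or `i₂` is affected; when `i₁` and `i₂` coincide both indicators fire and the
-- identity still balances.
transpose-term : (b : Fin n → Fin n → ℕ) (i₁ i₂ k : Fin n) →
  b k (transpose i₁ i₂ ⟨$⟩ʳ k)
    + ((if does (i₁ ≟ k) then b k k else 0) + (if does (i₂ ≟ k) then b k k else 0))
  ≡ b k k + ((if does (i₁ ≟ k) then b k i₂ else 0) + (if does (i₂ ≟ k) then b k i₁ else 0))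
transpose-term b i₁ i₂ k with i₁ ≟ k | i₂ ≟ k
-- `transpose` tests `k ≟ i₁` while the indicators test `i₁ ≟ k`; the rewrites evaluate the reversed
-- tests.
... | yes refl | yes refl rewrite dec-true (k ≟ k) refl = refl
... | yes refl | no _ rewrite dec-true (k ≟ k) refl = lemma (b k i₂) (b k k)
  where
  lemma : ∀ x y → x + (y + 0) ≡ y + (x + 0)
  lemma = solve-∀
... | no i₁≢k | yes refl
  rewrite dec-false (k ≟ i₁) (i₁≢k ∘ sym) | dec-true (k ≟ k) refl = +-comm (b k i₁) (b k k)
... | no i₁≢k | no i₂≢k
  rewrite dec-false (k ≟ i₁) (i₁≢k ∘ sym) | dec-false (k ≟ i₂) (i₂≢k ∘ sym) = refl

assignCost-transpose : (a : Fin n → Fin n → ℕ) (σ : Permutation′ n) (i₁ i₂ : Fin n) →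
  assignCost a (transpose i₁ i₂ ∘ₚ σ) + (a i₁ (σ ⟨$⟩ʳ i₁) + a i₂ (σ ⟨$⟩ʳ i₂))
  ≡ assignCost a σ + (a i₁ (σ ⟨$⟩ʳ i₂) + a i₂ (σ ⟨$⟩ʳ i₁))
assignCost-transpose {n} a σ i₁ i₂ = begin
  assignCost a (transpose i₁ i₂ ∘ₚ σ) + (b i₁ i₁ + b i₂ i₂)
    ≡⟨ expand (λ k → b k (transpose i₁ i₂ ⟨$⟩ʳ k)) (λ k → b k k) (λ k → b k k) ⟨
  (sum λ k → b k (transpose i₁ i₂ ⟨$⟩ʳ k) + (δ i₁ k (b k k) + δ i₂ k (b k k)))
    ≡⟨ sum-cong-≗ (transpose-term b i₁ i₂) ⟩
  (sum λ k → b k k + (δ i₁ k (b k i₂) + δ i₂ k (b k i₁)))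
    ≡⟨ expand (λ k → b k k) (λ k → b k i₂) (λ k → b k i₁) ⟩
  assignCost a σ + (b i₁ i₂ + b i₂ i₁) ∎
  where
  open ≡-Reasoning
  b : Fin n → Fin n → ℕ
  b i k = a i (σ ⟨$⟩ʳ k)
  δ : Fin n → Fin n → ℕ → ℕ
  δ i k x = if does (i ≟ k) then x else 0
  expand : ∀ f g h → (sum λ k → f k + (δ i₁ k (g k) + δ i₂ k (h k))) ≡ sum f + (g i₁ + h i₂)
  expand f g h = begin
    (sum λ k → f k + (δ i₁ k (g k) + δ i₂ k (h k)))
      ≡⟨ ∑-distrib-+ f (λ k → δ i₁ k (g k) + δ i₂ k (h k)) ⟩
    sum f + (sum λ k → δ i₁ k (g k) + δ i₂ k (h k))
      ≡⟨ cong (sum f ℕ.+_) (∑-distrib-+ (λ k → δ i₁ k (g k)) (λ k → δ i₂ k (h k))) ⟩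
    sum f + ((sum λ k → δ i₁ k (g k)) + (sum λ k → δ i₂ k (h k)))
      ≡⟨ cong (sum f ℕ.+_) (cong₂ _+_ (sum-select g i₁) (sum-select h i₂)) ⟩
    sum f + (g i₁ + h i₂) ∎

-- Over all ordered pairs each current entry is removed 2n times, which gives 2n times the cost.
-- Each entry of the matrix is inserted exactly twice, since σ merely permutes the columns.
∑assignCost-transpose : (a : Fin n → Fin n → ℕ) (σ : Permutation′ n) →
  (sum λ i₁ → sum λ i₂ → assignCost a (transpose i₁ i₂ ∘ₚ σ)) + 2 * n * assignCost a σ
  ≡ n * n * assignCost a σ + 2 * (sum λ i → sum λ j → a i j)
∑assignCost-transpose {n} a σ = begin
  S + 2 * n * g
    ≡⟨ cong (S ℕ.+_) (trans (lemma₁ n g) (sym (cong₂ _+_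
         (trans (sum-cong-≗ λ i₁ → sum-const n (b i₁ i₁)) (sym (*-distribˡ-sum n λ i → b i i)))
         (sum-const n g)))) ⟩
  S + ((sum λ i₁ → sum {n} λ i₂ → b i₁ i₁) + (sum {n} λ i₁ → sum λ i₂ → b i₂ i₂))
    ≡⟨ cong (S ℕ.+_) (sum-distrib₂ (λ i₁ i₂ → b i₁ i₁) (λ i₁ i₂ → b i₂ i₂)) ⟨
  S + (sum λ i₁ → sum λ i₂ → b i₁ i₁ + b i₂ i₂)
    ≡⟨ sum-distrib₂ (λ i₁ i₂ → assignCost a (transpose i₁ i₂ ∘ₚ σ)) (λ i₁ i₂ → b i₁ i₁ + b i₂ i₂) ⟨
  (sum λ i₁ → sum λ i₂ → assignCost a (transpose i₁ i₂ ∘ₚ σ) + (b i₁ i₁ + b i₂ i₂))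
    ≡⟨ sum-cong₂ (assignCost-transpose a σ) ⟩
  (sum λ i₁ → sum λ i₂ → g + (b i₁ i₂ + b i₂ i₁))
    ≡⟨ sum-distrib₂ {n} {n} (λ i₁ i₂ → g) (λ i₁ i₂ → b i₁ i₂ + b i₂ i₁) ⟩
  (sum {n} λ i₁ → sum {n} λ i₂ → g) + (sum λ i₁ → sum λ i₂ → b i₁ i₂ + b i₂ i₁)
    ≡⟨ cong₂ _+_ (trans (sum-cong-≗ {n} λ _ → sum-const n g) (sum-const n (n * g)))
         (trans (sum-distrib₂ b (λ i₁ i₂ → b i₂ i₁))
                (cong₂ _+_ ∑b (trans (sym (∑-comm b)) ∑b))) ⟩
  n * (n * g) + (W + W)
    ≡⟨ lemma₂ n g W ⟩
  n * n * g + 2 * W ∎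
  where
  open ≡-Reasoning
  g = assignCost a σ
  W = sum λ i → sum λ j → a i j
  S = sum λ i₁ → sum λ i₂ → assignCost a (transpose i₁ i₂ ∘ₚ σ)
  b : Fin n → Fin n → ℕ
  b i k = a i (σ ⟨$⟩ʳ k)
  ∑b : (sum λ i → sum λ k → b i k) ≡ W
  ∑b = sum-cong-≗ λ i → sym (sum-permute (a i) σ)
  lemma₁ : ∀ n g → 2 * n * g ≡ n * g + n * g
  lemma₁ = solve-∀
  lemma₂ : ∀ n g W → n * (n * g) + (W + W) ≡ n * n * g + 2 * W
  lemma₂ = solve-∀

-- A lower bound on every exchange is a lower bound on their average, whose value is known from
-- `∑assignCost-transpose`. The pairs with equal indices reproduce σ itself, hence the assumption on
-- the cost of σ.
exchange-bound : (a : Fin n → Fin n → ℕ) (σ : Permutation′ n) (B : ℕ) → B ≤ assignCost a σ →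
  (∀ {i₁ i₂} → i₁ ≢ i₂ → B ≤ assignCost a (transpose i₁ i₂ ∘ₚ σ)) →
  n * n * B + 2 * n * assignCost a σ ≤ n * n * assignCost a σ + 2 * (sum λ i → sum λ j → a i j)
exchange-bound {n} a σ B B≤σ B≤exchange = begin
  n * n * B + 2 * n * assignCost a σ
    ≡⟨ cong (_+ 2 * n * assignCost a σ)
         (trans (*-assoc n n B)
           (sym (trans (sum-cong-≗ {n} λ _ → sum-const n B) (sum-const n (n * B))))) ⟩
  (sum {n} λ _ → sum {n} λ _ → B) + 2 * n * assignCost a σ
    ≤⟨ +-monoˡ-≤ (2 * n * assignCost a σ) (sum-mono λ i₁ → sum-mono (B≤ i₁)) ⟩
  (sum λ i₁ → sum λ i₂ → assignCost a (transpose i₁ i₂ ∘ₚ σ)) + 2 * n * assignCost a σ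
    ≡⟨ ∑assignCost-transpose a σ ⟩
  n * n * assignCost a σ + 2 * (sum λ i → sum λ j → a i j) ∎
  where
  open ≤-Reasoning
  B≤ : ∀ i₁ i₂ → B ≤ assignCost a (transpose i₁ i₂ ∘ₚ σ)
  B≤ i₁ i₂ with i₁ ≟ i₂
  -- Cancelling the equal removed and inserted entries shows that the degenerate exchange leaves the
  -- cost unchanged.
  ... | yes refl = subst (B ≤_) (sym (+-cancelʳ-≡ _ _ _ (assignCost-transpose a σ i₁ i₁))) B≤σ
  ... | no i₁≢i₂ = B≤exchange i₁≢i₂

-- Averages over all permutations

-- Summing over positions makes the laws of finite sums, such as exchange of summation, available
-- for lists.
∑[_] : List A → (A → ℕ) → ℕ
∑[ xs ] f = sum λ i → f (lookup xs i)

∑-map-++ : (f : B → ℕ) (g : A → B) (xs : List A) (ys : List B) →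
           ∑[ map g xs ++ ys ] f ≡ ∑[ xs ] (f ∘ g) + ∑[ ys ] f
∑-map-++ f g []       ys = refl
∑-map-++ f g (x ∷ xs) ys = trans (cong (f (g x) ℕ.+_) (∑-map-++ f g xs ys)) (sym (+-assoc (f (g x)) _ _))

∑-cartesianProductWith : (f : C → ℕ) (g : A → B → C) (xs : List A) (ys : List B) →
  ∑[ cartesianProductWith g xs ys ] f ≡ ∑[ xs ] (λ x → ∑[ ys ] (λ y → f (g x y)))
∑-cartesianProductWith f g []       ys = refl
∑-cartesianProductWith f g (x ∷ xs) ys =
  trans (∑-map-++ f (g x) ys (cartesianProductWith g xs ys))
        (cong (∑[ ys ] (f ∘ g x) ℕ.+_) (∑-cartesianProductWith f g xs ys))

∑-tabulate : (f : A → ℕ) (g : Fin n → A) → ∑[ tabulate g ] f ≡ sum (f ∘ g)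
∑-tabulate {n = zero}  f g = refl
∑-tabulate {n = suc n} f g = cong (f (g zero) ℕ.+_) (∑-tabulate f (g ∘ suc))

∑-permutations : ∀ n (f : Permutation′ (suc n) → ℕ) →
  ∑[ permutations (suc n) ] f ≡ sum λ j → ∑[ permutations n ] (λ π → f (insert zero j π))
∑-permutations n f =
  trans (∑-cartesianProductWith f (insert zero) (allFin (suc n)) (permutations n))
        (∑-tabulate (λ j → ∑[ permutations n ] (λ π → f (insert zero j π))) (λ j → j))

length≡∑1 : (xs : List A) → length xs ≡ ∑[ xs ] (λ _ → 1)
length≡∑1 xs = sym (trans (sum-const (length xs) 1) (*-identityʳ _))

length-cartesianProductWith : (g : A → B → C) (xs : List A) (ys : List B) →
  length (cartesianProductWith g xs ys) ≡ length xs * length ys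
length-cartesianProductWith g xs ys = begin
  length (cartesianProductWith g xs ys)        ≡⟨ length≡∑1 (cartesianProductWith g xs ys) ⟩
  ∑[ cartesianProductWith g xs ys ] (λ _ → 1)  ≡⟨ ∑-cartesianProductWith (λ _ → 1) g xs ys ⟩
  ∑[ xs ] (λ _ → ∑[ ys ] (λ _ → 1))            ≡⟨ sum-const (length xs) _ ⟩
  length xs * ∑[ ys ] (λ _ → 1)                ≡⟨ cong (length xs *_) (length≡∑1 ys) ⟨
  length xs * length ys                        ∎
  where open ≡-Reasoning

length-permutations : ∀ n → length (permutations (suc n)) ≡ suc n * length (permutations n)
length-permutations n =
  trans (length-cartesianProductWith (insert zero) (allFin (suc n)) (permutations n))
        (cong (_* length (permutations n)) (length-tabulate {n = suc n} (λ i → i)))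

-- `punchIn j` runs through all indices except `j`, so adding `a j` back completes each inner sum to
-- `sum a`.
∑-punchIn : (a : Fin (suc n) → ℕ) → (sum λ j → sum λ k → a (punchIn j k)) ≡ n * sum a
∑-punchIn {n} a = +-cancelˡ-≡ (sum a) _ _ (begin
  sum a + (sum λ j → sum λ k → a (punchIn j k))  ≡⟨ ∑-distrib-+ a (λ j → sum λ k → a (punchIn j k)) ⟨
  (sum λ j → a j + (sum λ k → a (punchIn j k)))  ≡⟨ sum-cong-≗ (λ j → sum-remove {i = j} a) ⟨
  (sum {suc n} λ _ → sum a)                      ≡⟨ sum-const (suc n) (sum a) ⟩
  sum a + n * sum a                              ∎)
  where open ≡-Reasoning

-- A fixed index takes every value in equally many permutations, namely n!. At `zero` the inserted
-- value is the image; at `suc i` the image is that of `i` under the smaller permutation, shifted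
-- past the inserted value, and `∑-punchIn` counts the shifts.
∑-permutations-at : ∀ n (a : Fin (suc n) → ℕ) i →
  ∑[ permutations (suc n) ] (λ π → a (π ⟨$⟩ʳ i)) ≡ length (permutations n) * sum a
∑-permutations-at n a zero = begin
  ∑[ permutations (suc n) ] (λ π → a (π ⟨$⟩ʳ zero))  ≡⟨ ∑-permutations n (λ π → a (π ⟨$⟩ʳ zero)) ⟩
  (sum λ j → ∑[ permutations n ] (λ _ → a j))        ≡⟨ sum-cong-≗ (λ j → sum-const (length (permutations n)) (a j)) ⟩
  (sum λ j → length (permutations n) * a j)          ≡⟨ *-distribˡ-sum (length (permutations n)) a ⟨
  length (permutations n) * sum a                    ∎
  where open ≡-Reasoning
∑-permutations-at (suc n) a (suc i) = begin
  ∑[ permutations (suc (suc n)) ] (λ π → a (π ⟨$⟩ʳ suc i))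
    ≡⟨ ∑-permutations (suc n) (λ π → a (π ⟨$⟩ʳ suc i)) ⟩
  (sum λ j → ∑[ permutations (suc n) ] (λ π → a (insert zero j π ⟨$⟩ʳ suc i)))
    ≡⟨ sum-cong-≗ (λ j → sum-cong-≗ λ x → cong a (insert-punchIn zero j (lookup (permutations (suc n)) x) i)) ⟩
  (sum λ j → ∑[ permutations (suc n) ] (λ π → a (punchIn j (π ⟨$⟩ʳ i))))
    ≡⟨ sum-cong-≗ (λ j → ∑-permutations-at n (a ∘ punchIn j) i) ⟩
  (sum λ j → length (permutations n) * (sum λ k → a (punchIn j k)))
    ≡⟨ *-distribˡ-sum (length (permutations n)) (λ j → sum λ k → a (punchIn j k)) ⟨
  length (permutations n) * (sum λ j → sum λ k → a (punchIn j k))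
    ≡⟨ cong (length (permutations n) *_) (∑-punchIn a) ⟩
  length (permutations n) * (suc n * sum a)
    ≡⟨ lemma (length (permutations n)) (suc n) (sum a) ⟩
  suc n * length (permutations n) * sum a
    ≡⟨ cong (_* sum a) (length-permutations n) ⟨
  length (permutations (suc n)) * sum a ∎
  where
  open ≡-Reasoning
  lemma : ∀ l n s → l * (n * s) ≡ n * l * s
  lemma = solve-∀

-- The average linear assignment cost is 1/n of the sum of all entries, with denominators cleared:
-- each entry is used by (n - 1)! of the n! permutations.
∑-assignCost : ∀ n (a : Fin n → Fin n → ℕ) →
  n * ∑[ permutations n ] (assignCost a) ≡ length (permutations n) * (sum λ i → sum λ j → a i j)
∑-assignCost zero    a = refl
∑-assignCost (suc n) a = begin
  suc n * ∑[ permutations (suc n) ] (assignCost a)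
    ≡⟨ cong (suc n *_) (∑-comm λ x i → a i (lookup (permutations (suc n)) x ⟨$⟩ʳ i)) ⟩
  suc n * (sum λ i → ∑[ permutations (suc n) ] (λ π → a i (π ⟨$⟩ʳ i)))
    ≡⟨ cong (suc n *_) (sum-cong-≗ λ i → ∑-permutations-at n (a i) i) ⟩
  suc n * (sum λ i → length (permutations n) * sum (a i))
    ≡⟨ cong (suc n *_) (*-distribˡ-sum (length (permutations n)) (sum ∘ a)) ⟨
  suc n * (length (permutations n) * sum (sum ∘ a))
    ≡⟨ *-assoc (suc n) (length (permutations n)) (sum (sum ∘ a)) ⟨
  suc n * length (permutations n) * sum (sum ∘ a)
    ≡⟨ cong (_* sum (sum ∘ a)) (length-permutations n) ⟨
  length (permutations (suc n)) * sum (sum ∘ a) ∎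
  where open ≡-Reasoning

-- Sequences with a contracting excess

module Contraction (F : ℕ → ℕ) (N P C : ℕ) .{{_ : NonZero N}}
  -- Multiplied by `P`, this says N E(t+1) ≤ (N - P) E(t) for the excess E(t) = P F(t) - C, an
  -- integer that may be negative.
  (contraction : ∀ t → N * F (suc t) + P * F t ≤ N * F t + C)
  (decreasing : ∀ t → F (suc t) ≤ F t) where

  antitone : ∀ h t → F (h + t) ≤ F t
  antitone zero    t = ≤-refl
  antitone (suc h) t = ≤-trans (decreasing (h + t)) (antitone h t)

  -- Adds up `h` consecutive contractions, replacing each value of `F` in the gain term by the last,
  -- which is the smallest.
  telescope : ∀ h t → N * F (h + t) + h * (P * F (h + t)) ≤ N * F t + h * C
  telescope zero    t = ≤-refl
  telescope (suc h) t = begin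
    N * F (suc h + t) + suc h * (P * F (suc h + t))
      ≤⟨ +-monoʳ-≤ (N * F (suc h + t)) (*-monoʳ-≤ (suc h) (*-monoʳ-≤ P (decreasing (h + t)))) ⟩
    N * F (suc h + t) + suc h * (P * F (h + t))
      ≡⟨ +-assoc (N * F (suc h + t)) (P * F (h + t)) (h * (P * F (h + t))) ⟨
    N * F (suc h + t) + P * F (h + t) + h * (P * F (h + t))
      ≤⟨ +-monoˡ-≤ (h * (P * F (h + t))) (contraction (h + t)) ⟩
    N * F (h + t) + C + h * (P * F (h + t))
      ≡⟨ lemma (N * F (h + t)) C (h * (P * F (h + t))) ⟩
    N * F (h + t) + h * (P * F (h + t)) + C
      ≤⟨ +-monoˡ-≤ C (telescope h t) ⟩
    N * F t + h * C + C
      ≡⟨ trans (+-assoc (N * F t) (h * C) C) (cong (N * F t ℕ.+_) (+-comm (h * C) C)) ⟩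
    N * F t + suc h * C ∎
    where
    open ≤-Reasoning
    lemma : ∀ x y z → x + y + z ≡ x + z + y
    lemma = solve-∀

  -- In terms of the excess E this is 2 E(h+t) ≤ E(t). As long as the excess stays above E(h+t),
  -- each step lowers P F by at least (P/N) E(h+t), so `h` steps lower it by at least E(h+t). No
  -- power of 1 - P/N has to be estimated. If the final excess is not positive, monotonicity
  -- suffices.
  halving : ∀ h t → N ≤ h * P → 2 * (P * F (h + t)) ≤ P * F t + C
  halving h t N≤hP with ≤-total (P * F (h + t)) C
  ... | inj₁ y≤C = begin
    2 * (P * F (h + t))             ≡⟨ cong (P * F (h + t) ℕ.+_) (+-identityʳ _) ⟩
    P * F (h + t) + P * F (h + t)   ≤⟨ +-mono-≤ (*-monoʳ-≤ P (antitone h t)) y≤C ⟩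
    P * F t + C                     ∎
    where open ≤-Reasoning
  ... | inj₂ C≤y = begin
    2 * y        ≡⟨ cong (y ℕ.+_) (trans (+-identityʳ y) (sym (m∸n+n≡m C≤y))) ⟩
    y + (e + C)  ≡⟨ +-assoc y e C ⟨
    y + e + C    ≤⟨ +-monoˡ-≤ C y+e≤x ⟩
    x + C        ∎
    where
    open ≤-Reasoning
    x = P * F t
    y = P * F (h + t)
    e = y ∸ C
    lemma₁ : ∀ N H y e C → N * y + H * e + H * C ≡ N * y + H * (e + C)
    lemma₁ = solve-∀
    lemma₂ : ∀ N h P f → N * (P * f) + h * P * (P * f) ≡ P * (N * f + h * (P * f))
    lemma₂ = solve-∀
    lemma₃ : ∀ N h P f C → P * (N * f + h * C) ≡ N * (P * f) + h * P * C
    lemma₃ = solve-∀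
    -- This is `telescope` multiplied by `P`, with `C` split off from `y`.
    Ny+He≤Nx : N * y + h * P * e ≤ N * x
    Ny+He≤Nx = +-cancelʳ-≤ (h * P * C) _ _ (begin
      N * y + h * P * e + h * P * C  ≡⟨ lemma₁ N (h * P) y e C ⟩
      N * y + h * P * (e + C)        ≡⟨ cong (λ z → N * y + h * P * z) (m∸n+n≡m C≤y) ⟩
      N * y + h * P * y              ≡⟨ lemma₂ N h P (F (h + t)) ⟩
      P * (N * F (h + t) + h * y)    ≤⟨ *-monoʳ-≤ P (telescope h t) ⟩
      P * (N * F t + h * C)          ≡⟨ lemma₃ N h P (F t) C ⟩
      N * x + h * P * C              ∎)
    y+e≤x : y + e ≤ x
    y+e≤x = *-cancelˡ-≤ N (begin
      N * (y + e)        ≡⟨ *-distribˡ-+ N y e ⟩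
      N * y + N * e      ≤⟨ +-monoʳ-≤ (N * y) (*-monoˡ-≤ e N≤hP) ⟩
      N * y + h * P * e  ≤⟨ Ny+He≤Nx ⟩
      N * x              ∎)

  -- Iterates `halving`, with the initial excess P F(0) - C relaxed to P F(0).
  geometric : ∀ h k → N ≤ h * P → 2 ^ k * (P * F (k * h)) ≤ P * F 0 + 2 ^ k * C
  geometric h zero    N≤hP = ≤-trans (≤-reflexive (*-identityˡ _)) (m≤m+n _ _)
  geometric h (suc k) N≤hP = begin
    2 * 2 ^ k * (P * F (h + k * h))      ≡⟨ lemma₁ (2 ^ k) (P * F (h + k * h)) ⟩
    2 ^ k * (2 * (P * F (h + k * h)))    ≤⟨ *-monoʳ-≤ (2 ^ k) (halving h (k * h) N≤hP) ⟩
    2 ^ k * (P * F (k * h) + C)          ≡⟨ *-distribˡ-+ (2 ^ k) (P * F (k * h)) C ⟩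
    2 ^ k * (P * F (k * h)) + 2 ^ k * C  ≤⟨ +-monoˡ-≤ (2 ^ k * C) (geometric h k N≤hP) ⟩
    P * F 0 + 2 ^ k * C + 2 ^ k * C      ≡⟨ lemma₂ (P * F 0) (2 ^ k) C ⟩
    P * F 0 + 2 * 2 ^ k * C              ∎
    where
    open ≤-Reasoning
    lemma₁ : ∀ x y → 2 * x * y ≡ x * (2 * y)
    lemma₁ = solve-∀
    lemma₂ : ∀ x y z → x + y * z + y * z ≡ x + 2 * y * z
    lemma₂ = solve-∀

  -- Once the excess P F − C is below P, the next strict decrease removes it by integrality.
  reaches : .{{_ : NonZero P}} → (∀ t → F (suc t) < F t ⊎ P * F t ≤ C) →
            ∀ h k → N ≤ h * P → F 0 < 2 ^ k → P * F (suc (k * h)) ≤ C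
  reaches progress h k N≤hP F₀<2ᵏ with progress (k * h)
  ... | inj₂ PF≤C = ≤-trans (*-monoʳ-≤ P (decreasing (k * h))) PF≤C
  ... | inj₁ F′<F = <⇒≤ (+-cancelˡ-< P _ _ (begin-strict
    P + P * F (suc (k * h))  ≡⟨ *-suc P (F (suc (k * h))) ⟨
    P * suc (F (suc (k * h))) ≤⟨ *-monoʳ-≤ P F′<F ⟩
    -- The initial excess is less than 2^k P, so `k` halvings leave less than `P`.
    P * F (k * h)            <⟨ *-cancelˡ-< (2 ^ k) _ _ (begin-strict
        2 ^ k * (P * F (k * h))  ≤⟨ geometric h k N≤hP ⟩
        P * F 0 + 2 ^ k * C      <⟨ +-monoˡ-< (2 ^ k * C) (*-monoʳ-< P F₀<2ᵏ) ⟩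
        P * 2 ^ k + 2 ^ k * C    ≡⟨ cong (_+ 2 ^ k * C) (*-comm P (2 ^ k)) ⟩
        2 ^ k * P + 2 ^ k * C    ≡⟨ *-distribˡ-+ (2 ^ k) P C ⟨
        2 ^ k * (P + C)          ∎) ⟩
    P + C ∎))
    where open ≤-Reasoning

-- Counting the iterations

n<2^[1+⌊log₂n⌋] : ∀ n → n < 2 ^ suc ⌊log₂ n ⌋
n<2^[1+⌊log₂n⌋] n = ≰⇒> λ 2^≤n →
  1+n≰n (≤-trans (≤-reflexive (sym (⌊log₂[2^n]⌋≡n _))) (⌊log₂⌋-mono-≤ 2^≤n))

m≤[1+m/n]*n : ∀ m n .{{_ : NonZero n}} → m ≤ suc (m ℕ./ n) * n
m≤[1+m/n]*n m n = begin
  m                  ≡⟨ m≡m%n+[m/n]*n m n ⟩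
  m % n + m ℕ./ n * n  ≤⟨ +-monoˡ-≤ (m ℕ./ n * n) (<⇒≤ (m%n<n m n)) ⟩
  suc (m ℕ./ n) * n    ∎
  where open ≤-Reasoning

-- The constant is 5 = 1 + 2 · 2: one N ℓ pays for the final iteration, and the factors 2 come from
-- 1 + ℓ ≤ 2ℓ and p (1 + ⌊N/p⌋) ≤ 2N.
iterations-bound : ∀ N p ℓ .{{_ : NonZero p}} → p ≤ N → 1 ≤ ℓ →
                   p * suc (suc ℓ * suc (N ℕ./ p)) ≤ 5 * N * ℓ
iterations-bound N p ℓ p≤N 1≤ℓ = begin
  p * suc (suc ℓ * suc (N ℕ./ p))     ≡⟨ lemma₁ p ℓ (N ℕ./ p) ⟩
  p + (1 + ℓ) * (p + N ℕ./ p * p)     ≤⟨ +-mono-≤ p≤N (*-mono-≤ (+-monoˡ-≤ ℓ 1≤ℓ) (+-mono-≤ p≤N (m/n*n≤m N p))) ⟩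
  N + (ℓ + ℓ) * (N + N)             ≤⟨ +-monoˡ-≤ _ (≤-trans (≤-reflexive (sym (*-identityʳ N))) (*-monoʳ-≤ N 1≤ℓ)) ⟩
  N * ℓ + (ℓ + ℓ) * (N + N)         ≡⟨ lemma₂ N ℓ ⟩
  5 * N * ℓ ∎
  where
  open ≤-Reasoning
  lemma₁ : ∀ p ℓ q → p * suc (suc ℓ * suc q) ≡ p + (1 + ℓ) * (p + q * p)
  lemma₁ = solve-∀
  lemma₂ : ∀ N ℓ → N * ℓ + (ℓ + ℓ) * (N + N) ≡ 5 * N * ℓ
  lemma₂ = solve-∀

-- Natural numbers as rationals

toℚᵘ-/ : ∀ a b → toℚᵘ (+ a / suc b) ℚᵘ.≃ mkℚᵘ (+ a) b
toℚᵘ-/ a b = ℚ.toℚᵘ-fromℚᵘ (mkℚᵘ (+ a) b)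

-- `_/_` reduces to lowest terms, so the cross-multiplication is done on unnormalised rationals,
-- which keep the given numerator and denominator.
/-mono-≤ : ∀ a b c d .{{_ : NonZero b}} .{{_ : NonZero d}} → a * d ≤ c * b → + a / b ℚ.≤ + c / d
/-mono-≤ a (suc b) c (suc d) ad≤cb = ℚ.toℚᵘ-cancel-≤
  (ℚᵘ.≤-respˡ-≃ (ℚᵘ.≃-sym (toℚᵘ-/ a b)) (ℚᵘ.≤-respʳ-≃ (ℚᵘ.≃-sym (toℚᵘ-/ c d))
    (*≤* (subst₂ ℤ._≤_ (ℤ.pos-* a (suc d)) (ℤ.pos-* c (suc b)) (+≤+ ad≤cb)))))

/-*-homo : ∀ a b c d .{{_ : NonZero b}} .{{_ : NonZero d}} →
           (+ a / b) ℚ.* (+ c / d) ≡ _/_ (+ (a * c)) (b * d) {{m*n≢0 b d}}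
/-*-homo a (suc b) c (suc d) = ℚ.toℚᵘ-injective (begin
  toℚᵘ ((+ a / suc b) ℚ.* (+ c / suc d))          ≈⟨ ℚ.toℚᵘ-homo-* (+ a / suc b) (+ c / suc d) ⟩
  toℚᵘ (+ a / suc b) ℚᵘ.* toℚᵘ (+ c / suc d)      ≈⟨ ℚᵘ.*-cong (toℚᵘ-/ a b) (toℚᵘ-/ c d) ⟩
  mkℚᵘ (+ a) b ℚᵘ.* mkℚᵘ (+ c) d                  ≡⟨ cong (λ z → mkℚᵘ z (d + b * suc d)) (ℤ.pos-* a c) ⟨
  mkℚᵘ (+ (a * c)) (d + b * suc d)                ≈⟨ toℚᵘ-/ (a * c) (d + b * suc d) ⟨
  toℚᵘ (+ (a * c) / (suc b * suc d))              ∎)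
  where open ℚᵘ.≃-Reasoning

ℕ→ℚ-+ : ∀ a b → ℕ→ℚ (a + b) ≡ ℕ→ℚ a ℚ.+ ℕ→ℚ b
ℕ→ℚ-+ a b = ℚ.toℚᵘ-injective (begin
  toℚᵘ (ℕ→ℚ (a + b))                  ≈⟨ toℚᵘ-/ (a + b) 0 ⟩
  mkℚᵘ (+ (a + b)) 0                  ≡⟨ cong₂ (λ x y → mkℚᵘ (x ℤ.+ y) 0) (ℤ.*-identityʳ (+ a)) (ℤ.*-identityʳ (+ b)) ⟨
  mkℚᵘ (+ a) 0 ℚᵘ.+ mkℚᵘ (+ b) 0      ≈⟨ ℚᵘ.+-cong (toℚᵘ-/ a 0) (toℚᵘ-/ b 0) ⟨
  toℚᵘ (ℕ→ℚ a) ℚᵘ.+ toℚᵘ (ℕ→ℚ b)      ≈⟨ ℚ.toℚᵘ-homo-+ (ℕ→ℚ a) (ℕ→ℚ b) ⟨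
  toℚᵘ (ℕ→ℚ a ℚ.+ ℕ→ℚ b)              ∎)
  where open ℚᵘ.≃-Reasoning

ℕ→ℚ-mono-≤ : ∀ {a b} → a ≤ b → ℕ→ℚ a ℚ.≤ ℕ→ℚ b
ℕ→ℚ-mono-≤ {a} {b} a≤b = /-mono-≤ a 1 b 1 (*-monoˡ-≤ 1 a≤b)

ℕ→ℚ-cancel-≤ : ∀ {a b} → ℕ→ℚ a ℚ.≤ ℕ→ℚ b → a ≤ b
ℕ→ℚ-cancel-≤ {a} {b} a≤b
  with *≤* +a*1≤+b*1 ← ℚᵘ.≤-respˡ-≃ (toℚᵘ-/ a 0) (ℚᵘ.≤-respʳ-≃ (toℚᵘ-/ b 0) (ℚ.toℚᵘ-mono-≤ a≤b)) =
  ℤ.drop‿+≤+ (ℤ.*-cancelʳ-≤-pos (+ a) (+ b) (+ 1) +a*1≤+b*1)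

ℕ→ℚ-cancel-< : ∀ {a b} → ℕ→ℚ a ℚ.< ℕ→ℚ b → a < b
ℕ→ℚ-cancel-< a<b = ≰⇒> λ b≤a → ℚ.<-irrefl refl (ℚ.<-≤-trans a<b (ℕ→ℚ-mono-≤ b≤a))

ℕ→ℚ-sum : (f : Fin n → ℕ) → ℚΣ.sum (λ i → ℕ→ℚ (f i)) ≡ ℕ→ℚ (sum f)
ℕ→ℚ-sum {zero}  f = refl
ℕ→ℚ-sum {suc n} f = trans (cong (ℕ→ℚ (f zero) ℚ.+_) (ℕ→ℚ-sum (f ∘ suc))) (sym (ℕ→ℚ-+ (f zero) _))

≤-average : ∀ f p q S l .{{_ : NonZero p}} .{{_ : NonZero l}} → f * (p * l) ≤ q * S →
            ℕ→ℚ f ℚ.≤ (+ q / p) ℚ.* (ℕ→ℚ S ℚ.* (+ 1 / l))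
≤-average f p q S l {{p≢0}} fpl≤qS = begin
  ℕ→ℚ f                                  ≤⟨ /-mono-≤ f 1 (q * (S * 1)) (p * (1 * l)) {{_}} {{nz₂}} bound ⟩
  _/_ (+ (q * (S * 1))) (p * (1 * l)) {{nz₂}}   ≡⟨ /-*-homo q p (S * 1) (1 * l) {{p≢0}} {{nz₁}} ⟨
  (+ q / p) ℚ.* (_/_ (+ (S * 1)) (1 * l) {{nz₁}}) ≡⟨ cong ((+ q / p) ℚ.*_) (/-*-homo S 1 1 l) ⟨
  (+ q / p) ℚ.* (ℕ→ℚ S ℚ.* (+ 1 / l))    ∎
  where
  open ℚ.≤-Reasoning
  nz₁ : NonZero (1 * l)
  nz₁ = m*n≢0 1 l
  nz₂ : NonZero (p * (1 * l))
  nz₂ = m*n≢0 p (1 * l) {{p≢0}} {{nz₁}}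
  bound : f * (p * (1 * l)) ≤ q * (S * 1) * 1
  bound rewrite *-identityˡ l | *-identityʳ S | *-identityʳ (q * S) = fpl≤qS

≤-ratio : ∀ t K N p ℓ .{{_ : NonZero p}} → p * t ≤ K * N * ℓ →
          ℕ→ℚ t ℚ.≤ ℕ→ℚ K ℚ.* (+ N / p) ℚ.* ℕ→ℚ ℓ
≤-ratio t K N p ℓ pt≤KNℓ = begin
  ℕ→ℚ t                                 ≤⟨ /-mono-≤ t 1 (K * N * ℓ) (1 * p * 1) {{_}} {{nz₂}} bound ⟩
  _/_ (+ (K * N * ℓ)) (1 * p * 1) {{nz₂}} ≡⟨ /-*-homo (K * N) (1 * p) ℓ 1 {{nz₁}} ⟨
  (_/_ (+ (K * N)) (1 * p) {{nz₁}}) ℚ.* ℕ→ℚ ℓ ≡⟨ cong (ℚ._* ℕ→ℚ ℓ) (/-*-homo K 1 N p) ⟨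
  ℕ→ℚ K ℚ.* (+ N / p) ℚ.* ℕ→ℚ ℓ         ∎
  where
  open ℚ.≤-Reasoning
  nz₁ : NonZero (1 * p)
  nz₁ = m*n≢0 1 p
  nz₂ : NonZero (1 * p * 1)
  nz₂ = m*n≢0 (1 * p) 1 {{nz₁}}
  bound : t * (1 * p * 1) ≤ K * N * ℓ * 1
  bound rewrite *-identityʳ (1 * p) | *-identityˡ p | *-identityʳ (K * N * ℓ) | *-comm t p = pt≤KNℓ

-- Bilinear assignment with natural-number costs

Costs : ℕ → ℕ → Set
Costs m n = Fin m → Fin m → Fin n → Fin n → ℕ

-- The nesting displays the cost, for fixed τ, as a linear assignment cost in σ; `natCost-comm`
-- gives the view with the roles exchanged.
natCost : Costs m n → Solution m n → ℕ
natCost Q (σ , τ) = assignCost (λ i j → assignCost (Q i j) τ) σ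

natCost-comm : (Q : Costs m n) (σ : Permutation′ m) (τ : Permutation′ n) →
  natCost Q (σ , τ) ≡ assignCost (λ k l → sum λ i → Q i (σ ⟨$⟩ʳ i) k l) τ
natCost-comm Q σ τ = ∑-comm λ i k → Q i (σ ⟨$⟩ʳ i) k (τ ⟨$⟩ʳ k)

assignCost≤sum : (a : Fin n → Fin n → ℕ) (σ : Permutation′ n) →
                 assignCost a σ ≤ (sum λ i → sum λ j → a i j)
assignCost≤sum a σ = sum-mono λ i → term≤sum (a i) (σ ⟨$⟩ʳ i)

x-sum≤total : (Q : Costs m n) (τ : Permutation′ n) →
              (sum λ i → sum λ j → assignCost (Q i j) τ) ≤ total Q
x-sum≤total Q τ = sum-mono λ i → sum-mono λ j → assignCost≤sum (Q i j) τ

y-sum≤total : (Q : Costs m n) (σ : Permutation′ m) →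
              (sum λ k → sum λ l → sum λ i → Q i (σ ⟨$⟩ʳ i) k l) ≤ total Q
y-sum≤total Q σ = ≤-trans (≤-reflexive (sym (∑-comm₂ λ i → Q i (σ ⟨$⟩ʳ i))))
  (assignCost≤sum (λ i j → sum λ k → sum λ l → Q i j k l) σ)

natCost≤total : (Q : Costs m n) (s : Solution m n) → natCost Q s ≤ total Q
natCost≤total Q (σ , τ) = ≤-trans (assignCost≤sum _ σ) (x-sum≤total Q τ)

-- Adds `exchange-bound` for σ with τ fixed to that for τ with σ fixed. In each, the sum of the
-- linear costs is at most T because entries of `Q` are nonnegative; twice 2T makes 4T. In use, `B`
-- is the cost after the next move.
neighborhood-bound : (Q : Costs m n) (s : Solution m n) (B : ℕ) → B ≤ natCost Q s →
  (∀ {r} → r ∈𝒩 s → B ≤ natCost Q r) →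
  (m * m + n * n) * B + 2 * (m + n) * natCost Q s ≤ (m * m + n * n) * natCost Q s + 4 * total Q
neighborhood-bound {m} {n} Q (σ , τ) B B≤s B≤𝒩 = begin
  (m * m + n * n) * B + 2 * (m + n) * f
    ≡⟨ lemma₁ m n B f ⟩
  (m * m * B + 2 * m * f) + (n * n * B + 2 * n * f)
    ≤⟨ +-mono-≤ (≤-trans x-bound (+-monoʳ-≤ (m * m * f) (*-monoʳ-≤ 2 (x-sum≤total Q τ))))
                (≤-trans y-bound (+-monoʳ-≤ (n * n * f) (*-monoʳ-≤ 2 (y-sum≤total Q σ)))) ⟩
  (m * m * f + 2 * total Q) + (n * n * f + 2 * total Q)
    ≡⟨ lemma₂ m n f (total Q) ⟩
  (m * m + n * n) * f + 4 * total Q ∎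
  where
  open ≤-Reasoning
  f = natCost Q (σ , τ)
  b : Fin n → Fin n → ℕ
  b k l = sum λ i → Q i (σ ⟨$⟩ʳ i) k l
  x-bound : m * m * B + 2 * m * f ≤ m * m * f + 2 * (sum λ i → sum λ j → assignCost (Q i j) τ)
  x-bound = exchange-bound (λ i j → assignCost (Q i j) τ) σ B B≤s
    λ {i₁} {i₂} i₁≢i₂ → B≤𝒩 (swapˣ i₁ i₂ i₁≢i₂)
  y-bound : n * n * B + 2 * n * f ≤ n * n * f + 2 * (sum λ k → sum λ l → b k l)
  y-bound = subst (λ g → n * n * B + 2 * n * g ≤ n * n * g + 2 * (sum λ k → sum λ l → b k l))
    (sym (natCost-comm Q σ τ))
    (exchange-bound b τ B (subst (B ≤_) (natCost-comm Q σ τ) B≤s)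
      λ {k₁} {k₂} k₁≢k₂ → subst (B ≤_) (natCost-comm Q σ (transpose k₁ k₂ ∘ₚ τ))
        (B≤𝒩 (swapʸ k₁ k₂ k₁≢k₂)))
  lemma₁ : ∀ m n B f →
    (m * m + n * n) * B + 2 * (m + n) * f ≡ (m * m * B + 2 * m * f) + (n * n * B + 2 * n * f)
  lemma₁ = solve-∀
  lemma₂ : ∀ m n f T →
    (m * m * f + 2 * T) + (n * n * f + 2 * T) ≡ (m * m + n * n) * f + 4 * T
  lemma₂ = solve-∀

-- This is T = mn 𝒜 without denominators: average over σ for each fixed τ, then over τ for each pair
-- of indices i, j.
∑-natCost : (Q : Costs m n) →
  m * (n * ∑[ solutions m n ] (natCost Q)) ≡ length (solutions m n) * total Q
∑-natCost {m} {n} Q = begin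
  m * (n * ∑[ solutions m n ] (natCost Q))
    ≡⟨ cong (λ z → m * (n * z)) (trans (∑-cartesianProductWith (natCost Q) _,_ Pₘ Pₙ)
         (∑-comm λ x y → natCost Q (lookup Pₘ x , lookup Pₙ y))) ⟩
  m * (n * ∑[ Pₙ ] (λ τ → ∑[ Pₘ ] (λ σ → natCost Q (σ , τ))))
    ≡⟨ lemma₁ m n _ ⟩
  n * (m * ∑[ Pₙ ] (λ τ → ∑[ Pₘ ] (λ σ → natCost Q (σ , τ))))
    ≡⟨ cong (n *_) (*-distribˡ-sum m λ y → ∑[ Pₘ ] (λ σ → natCost Q (σ , lookup Pₙ y))) ⟩
  n * ∑[ Pₙ ] (λ τ → m * ∑[ Pₘ ] (λ σ → natCost Q (σ , τ)))
    ≡⟨ cong (n *_) (sum-cong-≗ λ y → ∑-assignCost m λ i j → assignCost (Q i j) (lookup Pₙ y)) ⟩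
  n * ∑[ Pₙ ] (λ τ → length Pₘ * (sum λ i → sum λ j → assignCost (Q i j) τ))
    ≡⟨ cong (n *_) (*-distribˡ-sum (length Pₘ)
         λ y → sum λ i → sum λ j → assignCost (Q i j) (lookup Pₙ y)) ⟨
  n * (length Pₘ * ∑[ Pₙ ] (λ τ → sum λ i → sum λ j → assignCost (Q i j) τ))
    ≡⟨ cong (λ z → n * (length Pₘ * z)) (∑-comm₂ λ y i j → assignCost (Q i j) (lookup Pₙ y)) ⟩
  n * (length Pₘ * (sum λ i → sum λ j → ∑[ Pₙ ] (assignCost (Q i j))))
    ≡⟨ lemma₁ n (length Pₘ) _ ⟩
  length Pₘ * (n * (sum λ i → sum λ j → ∑[ Pₙ ] (assignCost (Q i j))))
    ≡⟨ cong (length Pₘ *_) (*-distribˡ-sum₂ n λ i j → ∑[ Pₙ ] (assignCost (Q i j))) ⟩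
  length Pₘ * (sum λ i → sum λ j → n * ∑[ Pₙ ] (assignCost (Q i j)))
    ≡⟨ cong (length Pₘ *_) (sum-cong₂ λ i j → ∑-assignCost n (Q i j)) ⟩
  length Pₘ * (sum λ i → sum λ j → length Pₙ * (sum λ k → sum λ l → Q i j k l))
    ≡⟨ cong (length Pₘ *_) (*-distribˡ-sum₂ (length Pₙ) λ i j → sum λ k → sum λ l → Q i j k l) ⟨
  length Pₘ * (length Pₙ * total Q)
    ≡⟨ *-assoc (length Pₘ) (length Pₙ) (total Q) ⟨
  length Pₘ * length Pₙ * total Q
    ≡⟨ cong (_* total Q) (length-cartesianProductWith _,_ Pₘ Pₙ) ⟨
  length (solutions m n) * total Q ∎
  where
  open ≡-Reasoning
  Pₘ = permutations m
  Pₙ = permutations n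
  lemma₁ : ∀ m n x → m * (n * x) ≡ n * (m * x)
  lemma₁ = solve-∀

-- From rational costs to natural-number costs

ℚsum-zero : {f : Fin m → Fin n → ℚ} → (∀ i j → f i j ≡ 0ℚ) → (ℚΣ.sum λ i → ℚΣ.sum λ j → f i j) ≡ 0ℚ
ℚsum-zero {m} {n} f≡0 = trans
  (ℚΣ.sum-cong-≗ λ i → trans (ℚΣ.sum-cong-≗ (f≡0 i)) (ℚΣ.sum-replicate-zero n))
  (ℚΣ.sum-replicate-zero m)

sum-if₂ : ∀ b (f : Fin m → Fin n → ℕ) →
  (sum λ k → sum λ l → if b then f k l else 0) ≡ (if b then (sum λ k → sum λ l → f k l) else 0)
sum-if₂ true f = refl
sum-if₂ {m} {n} false f =
  trans (sum-cong-≗ {m} λ _ → sum-replicate-zero n) (sum-replicate-zero m)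

*-indicators : ∀ z b b′ →
  ℕ→ℚ z ℚ.* (if b then 1ℚ else 0ℚ) ℚ.* (if b′ then 1ℚ else 0ℚ)
  ≡ ℕ→ℚ (if b then (if b′ then z else 0) else 0)
*-indicators z true  true  = trans (ℚ.*-identityʳ _) (ℚ.*-identityʳ _)
*-indicators z true  false = ℚ.*-zeroʳ (ℕ→ℚ z ℚ.* 1ℚ)
*-indicators z false b′    =
  trans (cong (ℚ._* (if b′ then 1ℚ else 0ℚ)) (ℚ.*-zeroʳ (ℕ→ℚ z))) (ℚ.*-zeroˡ (if b′ then 1ℚ else 0ℚ))

module _ (I : Instance m n) (Q : Costs m n)
  (q≡Q : ∀ i j k l → Instance.q I i j k l ≡ ℕ→ℚ (Q i j k l))
  (c≡0 : ∀ i j → Instance.c I i j ≡ 0ℚ)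
  (d≡0 : ∀ k l → Instance.d I k l ≡ 0ℚ) where

  open Instance I

  cost≡natCost : ∀ s → cost I s ≡ ℕ→ℚ (natCost Q s)
  cost≡natCost (σ , τ) = begin
    cost I (σ , τ)
      ≡⟨ cong₂ ℚ._+_ (cong₂ ℚ._+_ bilinear≡ (linear≡0 c c≡0 σ)) (linear≡0 d d≡0 τ) ⟩
    ℕ→ℚ (natCost Q (σ , τ)) ℚ.+ 0ℚ ℚ.+ 0ℚ
      ≡⟨ trans (ℚ.+-identityʳ _) (ℚ.+-identityʳ _) ⟩
    ℕ→ℚ (natCost Q (σ , τ)) ∎
    where
    open ≡-Reasoning
    x = permMatrix σ
    y = permMatrix τ

    linear≡0 : ∀ {r} (a : Matrix r) → (∀ i j → a i j ≡ 0ℚ) → (π : Permutation′ r) →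
               (ℚΣ.sum λ i → ℚΣ.sum λ j → a i j ℚ.* permMatrix π i j) ≡ 0ℚ
    linear≡0 a a≡0 π = ℚsum-zero λ i j →
      trans (cong (ℚ._* permMatrix π i j) (a≡0 i j)) (ℚ.*-zeroˡ (permMatrix π i j))

    t : Fin m → Fin m → Fin n → Fin n → ℕ
    t i j k l = if does (σ ⟨$⟩ʳ i ≟ j) then (if does (τ ⟨$⟩ʳ k ≟ l) then Q i j k l else 0) else 0

    -- The indicator of x is constant in k and l, so it moves out of the inner sums and selects j =
    -- σ(i); then the indicator of y selects l = τ(k).
    selected : ∀ i → (sum λ j → sum λ k → sum λ l → t i j k l) ≡ assignCost (Q i (σ ⟨$⟩ʳ i)) τ
    selected i = begin
      (sum λ j → sum λ k → sum λ l → t i j k l)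
        ≡⟨ sum-cong-≗ (λ j → sum-if₂ (does (σ ⟨$⟩ʳ i ≟ j))
             λ k l → if does (τ ⟨$⟩ʳ k ≟ l) then Q i j k l else 0) ⟩
      (sum λ j → if does (σ ⟨$⟩ʳ i ≟ j) then g j else 0)
        ≡⟨ sum-select g (σ ⟨$⟩ʳ i) ⟩
      g (σ ⟨$⟩ʳ i)
        ≡⟨ sum-cong-≗ (λ k → sum-select (Q i (σ ⟨$⟩ʳ i) k) (τ ⟨$⟩ʳ k)) ⟩
      assignCost (Q i (σ ⟨$⟩ʳ i)) τ ∎
      where
      g : Fin m → ℕ
      g j = sum λ k → sum λ l → if does (τ ⟨$⟩ʳ k ≟ l) then Q i j k l else 0

    bilinear≡ : (ℚΣ.sum λ i → ℚΣ.sum λ j → ℚΣ.sum λ k → ℚΣ.sum λ l → q i j k l ℚ.* x i j ℚ.* y k l)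
                ≡ ℕ→ℚ (natCost Q (σ , τ))
    bilinear≡ = begin
      (ℚΣ.sum λ i → ℚΣ.sum λ j → ℚΣ.sum λ k → ℚΣ.sum λ l → q i j k l ℚ.* x i j ℚ.* y k l)
        ≡⟨ (ℚΣ.sum-cong-≗ λ i → trans (ℚΣ.sum-cong-≗ λ j → trans (ℚΣ.sum-cong-≗ λ k →
             trans (ℚΣ.sum-cong-≗ λ l → term i j k l)
             (ℕ→ℚ-sum (t i j k))) (ℕ→ℚ-sum λ k → sum (t i j k)))
             (ℕ→ℚ-sum λ j → sum λ k → sum (t i j k))) ⟩
      (ℚΣ.sum λ i → ℕ→ℚ (sum λ j → sum λ k → sum λ l → t i j k l))
        ≡⟨ ℕ→ℚ-sum (λ i → sum λ j → sum λ k → sum λ l → t i j k l) ⟩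
      ℕ→ℚ (sum λ i → sum λ j → sum λ k → sum λ l → t i j k l)
        ≡⟨ cong ℕ→ℚ (sum-cong-≗ selected) ⟩
      ℕ→ℚ (natCost Q (σ , τ)) ∎
      where
      term : ∀ i j k l → q i j k l ℚ.* x i j ℚ.* y k l ≡ ℕ→ℚ (t i j k l)
      term i j k l = trans (cong (λ z → z ℚ.* x i j ℚ.* y k l) (q≡Q i j k l))
        (*-indicators (Q i j k l) (does (σ ⟨$⟩ʳ i ≟ j)) (does (τ ⟨$⟩ʳ k ≟ l)))

  ∑cost≡∑natCost : ∀ ss → foldr ℚ._+_ 0ℚ (map (cost I) ss) ≡ ℕ→ℚ (∑[ ss ] (natCost Q))
  ∑cost≡∑natCost []       = refl
  ∑cost≡∑natCost (s ∷ ss) = trans (cong₂ ℚ._+_ (cost≡natCost s) (∑cost≡∑natCost ss))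
    (sym (ℕ→ℚ-+ (natCost Q s) (∑[ ss ] (natCost Q))))

  -- By `∑-natCost`, 2T/(m + n) equals 2mn/(m + n) times the average.
  cost≤average : .{{_ : NonZero m}} → ∀ s → (m + n) * natCost Q s ≤ 2 * total Q →
                 cost I s ℚ.≤ (+ (2 * m * n) / (m + n)) ℚ.* 𝒜 I
  cost≤average s pf≤2T = subst₂ (λ f S → f ℚ.≤ (+ (2 * m * n) / (m + n)) ℚ.* (S ℚ.* avg))
    (sym (cost≡natCost s)) (sym (∑cost≡∑natCost (solutions m n)))
    (≤-average f (m + n) (2 * m * n) S l {{m+n-nonZero}} {{solutions-nonEmpty m n}} (begin
      f * ((m + n) * l)    ≡⟨ lemma₁ f (m + n) l ⟩
      l * ((m + n) * f)    ≤⟨ *-monoʳ-≤ l pf≤2T ⟩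
      l * (2 * total Q)    ≡⟨ lemma₂ l (total Q) ⟩
      2 * (l * total Q)    ≡⟨ cong (2 *_) (∑-natCost Q) ⟨
      2 * (m * (n * S))    ≡⟨ lemma₃ m n S ⟩
      2 * m * n * S        ∎))
    where
    open ≤-Reasoning
    f = natCost Q s
    S = ∑[ solutions m n ] (natCost Q)
    l = length (solutions m n)
    avg = _/_ (+ 1) l {{solutions-nonEmpty m n}}
    lemma₁ : ∀ f p l → f * (p * l) ≡ l * (p * f)
    lemma₁ = solve-∀
    lemma₂ : ∀ l T → l * (2 * T) ≡ 2 * (l * T)
    lemma₂ = solve-∀
    lemma₃ : ∀ m n S → 2 * (m * (n * S)) ≡ 2 * m * n * S
    lemma₃ = solve-∀

  -- Runs of the local search

  module _ .{{_ : NonZero m}} .{{_ : NonZero n}} (s : ℕ → Solution m n) (search : IsLocalSearch I s) where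

    private
      F : ℕ → ℕ
      F t = natCost Q (s t)

      N = m * m + n * n

      natCost-≤ : ∀ r r′ → cost I r ℚ.≤ cost I r′ → natCost Q r ≤ natCost Q r′
      natCost-≤ r r′ r≤r′ = ℕ→ℚ-cancel-≤ (subst₂ ℚ._≤_ (cost≡natCost r) (cost≡natCost r′) r≤r′)

      natCost-< : ∀ r r′ → cost I r ℚ.< cost I r′ → natCost Q r < natCost Q r′
      natCost-< r r′ r<r′ = ℕ→ℚ-cancel-< (subst₂ ℚ._<_ (cost≡natCost r) (cost≡natCost r′) r<r′)

      decreasing : ∀ t → F (suc t) ≤ F t
      decreasing t with search t
      ... | inj₁ it       = <⇒≤ (natCost-< (s (suc t)) (s t) (Iteration.decreases it))
      ... | inj₂ (_ , eq) = ≤-reflexive (cong (natCost Q) eq)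

      -- The next cost bounds the whole neighborhood from below in both cases: after an iteration it
      -- is the best neighbor's, and at a local optimum it is the current one.
      contraction : ∀ t → N * F (suc t) + 2 * (m + n) * F t ≤ N * F t + 4 * total Q
      contraction t = neighborhood-bound Q (s t) (F (suc t)) (decreasing t) (best (search t))
        where
        best : Iteration I (s t) (s (suc t)) ⊎ (LocalOptimum I (s t) × s (suc t) ≡ s t) →
               ∀ {r} → r ∈𝒩 s t → F (suc t) ≤ natCost Q r
        best (inj₁ it)         {r} r∈ = natCost-≤ (s (suc t)) r (Iteration.best it r∈)
        best (inj₂ (opt , eq)) {r} r∈ = ≤-trans (≤-reflexive (cong (natCost Q) eq)) (natCost-≤ (s t) r (opt r∈))

      progress : ∀ t → F (suc t) < F t ⊎ 2 * (m + n) * F t ≤ 4 * total Q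
      progress t with search t
      ... | inj₁ it       = inj₁ (natCost-< (s (suc t)) (s t) (Iteration.decreases it))
      -- Once the search has stopped, both sides of `contraction` share the term `N * F t`;
      -- cancelling it leaves a nonpositive excess.
      ... | inj₂ (_ , eq) = inj₂ (+-cancelˡ-≤ (N * F t) _ _
        (subst (λ r → N * natCost Q r + 2 * (m + n) * F t ≤ N * F t + 4 * total Q) eq (contraction t)))

    search-reaches : ∀ h k → m * m + n * n ≤ h * (m + n) → total Q < 2 ^ k →
                     (m + n) * natCost Q (s (suc (k * h))) ≤ 2 * total Q
    search-reaches h k N≤hp T<2ᵏ = *-cancelˡ-≤ 2 (begin
      2 * ((m + n) * F (suc (k * h)))  ≡⟨ *-assoc 2 (m + n) (F (suc (k * h))) ⟨
      2 * (m + n) * F (suc (k * h))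
        ≤⟨ Contraction.reaches F N (2 * (m + n)) (4 * total Q) {{N≢0}} contraction decreasing {{p≢0}} progress
             -- `h` is measured against m + n, half of the contraction parameter 2(m + n), so it is
             -- large enough.
             h k (≤-trans N≤hp (*-monoʳ-≤ h (m≤m+n (m + n) _)))
             (≤-<-trans (natCost≤total Q (s 0)) T<2ᵏ) ⟩
      4 * total Q                      ≡⟨ *-assoc 2 2 (total Q) ⟩
      2 * (2 * total Q)                ∎)
      where
      open ≤-Reasoning
      N≢0 : NonZero N
      N≢0 = m+n-nonZero {{m*n≢0 m m}}
      p≢0 : NonZero (2 * (m + n))
      p≢0 = m*n≢0 2 (m + n)

theorem8 : ∃[ K ] ∀ (m n : ℕ) .{{_ : NonZero m}} → m ℕ.≤ n →
    (I : Instance m n) (Q : Fin m → Fin m → Fin n → Fin n → ℕ) →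
    (∀ i j k l → Instance.q I i j k l ≡ ℕ→ℚ (Q i j k l)) →
    (∀ i j → Instance.c I i j ≡ 0ℚ) →
    (∀ k l → Instance.d I k l ≡ 0ℚ) →
    (s : ℕ → Solution m n) → IsLocalSearch I s →
    ∃[ t ] ( cost I (s t) ℚ.≤ (+ (2 ℕ.* m ℕ.* n) / (m ℕ.+ n)) ℚ.* 𝒜 I
    × ℕ→ℚ t ℚ.≤ ℕ→ℚ K ℚ.* (+ (m ℕ.* m ℕ.+ n ℕ.* n) / (m ℕ.+ n)) ℚ.* ℕ→ℚ ⌊log₂ (2 ℕ.⊔ total Q) ⌋ )
theorem8 = 5 , λ m n m≤n I Q q≡Q c≡0 d≡0 s search →
  let
    instance
      n≢0 : NonZero n
      n≢0 = ℕ.>-nonZero (≤-trans (ℕ.>-nonZero⁻¹ m) m≤n)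
    N = m * m + n * n
    p = m + n
    -- The maximum with 2 keeps ℓ ≥ 1 when the total is 0 or 1.
    ℓ = ⌊log₂ (2 ℕ.⊔ total Q) ⌋
    h = suc (N ℕ./ p)
    T<2^[1+ℓ] = ≤-<-trans (m≤n⊔m 2 (total Q)) (n<2^[1+⌊log₂n⌋] (2 ℕ.⊔ total Q))
    -- 1 + ℓ halvings of `h` iterations each, and one further iteration that uses integrality.
    t = suc (suc ℓ * h)
  in t
   , cost≤average I Q q≡Q c≡0 d≡0 (s t)
       (search-reaches I Q q≡Q c≡0 d≡0 s search h (suc ℓ) (m≤[1+m/n]*n N p) T<2^[1+ℓ])
   , ≤-ratio t 5 N p ℓ (iterations-bound N p ℓ (+-mono-≤ (m≤m*n m m) (m≤m*n n n))
       (⌊log₂⌋-mono-≤ (m≤m⊔n 2 (total Q))))
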